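{- Let $X$ be an unbounded thin metric space (with integer valued metric) such that $|X|=\mathrm{asden}(X)=\varkappa$. Then the following statements hold: (i) if $\varkappa=\aleph_0$, then $X$ is coarsely equivalent either to $T(1,1,\dots)$ or to $T(\aleph_0,\aleph_0,\dots)$; (ii) if $\mathrm{cf}(\varkappa)>\aleph_0$, then $X$ is coarsely equivalent to $T(\varkappa,\varkappa,\dots)$; (iii) if $\varkappa>\aleph_0$, $\mathrm{cf}(\varkappa)=\aleph_0$ and $(\varkappa_n')_{n\in\mathbb{N}}$ is a sequence of cardinals such that $\varkappa_n'<\varkappa_{n+1}'$ for each $n\in\mathbb{N}$ and $\sup\{\varkappa_n':n\in\mathbb{N}\}=\varkappa$, then $X$ is coarsely equivalent either to $T(\varkappa_n')_{n\in\mathbb{N}}$ or to $T(\varkappa,\varkappa,\dots)$.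
   Context: All metrics are supposed to take values in $\omega=\{0,1,2,\dots\}$; $\mathbb{N}=\{1,2,\dots\}$. For a metric space $(X,d)$, $x\in X$, $m\in\omega$, $L\subseteq X$, put $B(x,m)=\{y\in X:d(x,y)\le m\}$ and $B(L,m)=\bigcup_{x\in L}B(x,m)$. A subset $V\subseteq X$ is bounded if $V\subseteq B(x_0,n)$ for some $x_0\in X$, $n\in\omega$. $X$ is thin if for every $m\in\omega$ there is a bounded subset $V$ of $X$ such that $B(x,m)=\{x\}$ for each $x\in X\setminus V$. A subset $L\subseteq X$ is large if $B(L,m)=X$ for some $m\in\omega$. The asymptotic density $\mathrm{asden}(X)$ is the minimal cardinality of a large subset of $X$. For metric spaces $(X_1,d_1)$, $(X_2,d_2)$, a bijection $f:X_1\to X_2$ is an asymorphism if there are sequences $(c_n)_{n\in\omega}$, $(c_n')_{n\in\omega}$ in $\omega$ such that for all $n\in\omega$ and $x,y\in X_1$: $d_1(x,y)\le n\Rightarrow d_2(f(x),f(y))<c_n$, and $d_2(f(x),f(y))\le n\Rightarrow d_1(x,y)<c_n'$. Two metric spaces $X_1,X_2$ are coarsely equivalent if there are large subsets $L_1\subseteq X_1$, $L_2\subseteq X_2$ which, with the restricted metrics, are asymorphic. The space $T(\varkappa_n)_{n\in\mathbb{N}}=T(\varkappa_1,\varkappa_2,\dots)$: for an infinite cardinal $\varkappa$ and a partition $\varkappa=\bigcup_{n\in\mathbb{N}}K_n$ into countably many pairwise disjoint subsets with $|K_n|=\varkappa_n$, it is the set $\varkappa$ with the metric $\rho(x,x)=0$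 and $\rho(x,y)=\max\{n,m\}$ if $x\in K_n$, $y\in K_m$, $x\ne y$. (Up to isometry it depends only on the sequence of cardinals $(\varkappa_n)$.) -}

module Defs where

open import Data.Empty using (⊥; ⊥-elim)
open import Data.Fin.Base as Fin using (Fin; fromℕ<)
open import Data.Fin.Properties using (pigeonhole; fromℕ<-injective)
open import Data.Irrelevant using ([_])
open import Data.Nat.Base
  using (ℕ; suc; _+_; _≤_; _<_; _⊔_; z≤n)
open import Data.Nat.Induction using (<-wellFounded)
import Data.Nat.Properties as ℕ
open import Data.Product using (Σ; ∃; ∃-syntax; _×_; _,_; proj₁; proj₂)
import Data.Product.Properties as Product
open import Data.Refinement
  using (Refinement-syntax; _,_; value; value-injective)
open import Data.Sum.Base using (_⊎_)
open import Data.Unit.Base using (⊤; tt)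
open import Function.Bundles using (_↣_; _⤖_; module Bijection)
open import Function.Definitions using (Bijective)
open import Function.Metric.Nat.Core using (DistanceFunction)
open import Function.Metric.Nat.Structures using (IsMetric)
open import Induction.WellFounded using (WellFounded; acc)
open import Level using (Level; 0ℓ) renaming (_⊔_ to _⊔ℓ_; suc to lsuc)
open import Relation.Binary.Core using (Rel)
open import Relation.Binary.Definitions using (DecidableEquality; tri≈)
open import Relation.Binary.Structures using (IsStrictTotalOrder)
open import Relation.Binary.PropositionalEquality
  using (_≡_; refl; sym; trans; cong; cong₂; isEquivalence)
open import Relation.Nullary using (¬_; yes; no; recompute)
open import Relation.Unary using (Pred; _∈_; _∉_; _⊆_; U; _≐_; ｛_｝)

private
  variable
    a b : Level

-- The membership proof is irrelevant, so elements of ⟪ L ⟫ are equal as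
-- soon as the underlying elements are: ⟪ L ⟫ has exactly one element for
-- each element of L, even when L x is not a proposition.

⟪_⟫ : {A : Set a} → Pred A b → Set (a ⊔ℓ b)
⟪_⟫ {A = A} L = [ x ∈ A ∣ L x ]

-- As usual in set theory, a cardinal is an initial ordinal: a
-- well-ordered set that is not equinumerous with any of its proper
-- initial segments.

record Cardinal a : Set (lsuc a) where
  infix 4 _≺_
  field
    Carrier            : Set a
    _≺_                : Rel Carrier a
    isStrictTotalOrder : IsStrictTotalOrder _≡_ _≺_
    wellFounded        : WellFounded _≺_
    initial            : ∀ x → ¬ (⟪ _≺ x ⟫ ⤖ Carrier)

  open IsStrictTotalOrder isStrictTotalOrder public using (_≟_)

∣_∣ : Cardinal a → Set a
∣_∣ = Cardinal.Carrier

infix 4 _≈ᶜ_ _≤ᶜ_ _<ᶜ_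

_≈ᶜ_ : Cardinal a → Cardinal b → Set (a ⊔ℓ b)
κ ≈ᶜ μ = ∣ κ ∣ ⤖ ∣ μ ∣

_≤ᶜ_ : Cardinal a → Cardinal b → Set (a ⊔ℓ b)
κ ≤ᶜ μ = ∣ κ ∣ ↣ ∣ μ ∣

_<ᶜ_ : Cardinal a → Cardinal b → Set (a ⊔ℓ b)
κ <ᶜ μ = κ ≤ᶜ μ × ¬ (κ ≈ᶜ μ)

IsSupremum : (ℕ → Cardinal a) → Cardinal a → Set (lsuc a)
IsSupremum {a} κ′ κ =
  (∀ n → κ′ n ≤ᶜ κ) ×
  (∀ (μ : Cardinal a) → (∀ n → κ′ n ≤ᶜ μ) → κ ≤ᶜ μ)

IsLeastCardinality : {A : Set a} → Pred (Pred A a) a → Cardinal b →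
                     Set (lsuc a ⊔ℓ b)
IsLeastCardinality {a} {A = A} 𝓕 μ =
  (∃[ L ] 𝓕 L × (⟪ L ⟫ ⤖ ∣ μ ∣)) ×
  (∀ (L : Pred A a) → 𝓕 L → ∣ μ ∣ ↣ ⟪ L ⟫)

Cofinal : (κ : Cardinal a) → Pred (Pred ∣ κ ∣ a) a
Cofinal κ C = ∀ x → ∃[ y ] y ∈ C × (x ≺ y ⊎ x ≡ y)
  where open Cardinal κ

IsCofinality : Cardinal a → Cardinal b → Set (lsuc a ⊔ℓ b)
IsCofinality κ = IsLeastCardinality (Cofinal κ)

1ᶜ : Cardinal 0ℓ
1ᶜ = record
  { Carrier            = ⊤
  ; _≺_                = λ _ _ → ⊥
  ; isStrictTotalOrder = record
    { isStrictPartialOrder = record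
      { isEquivalence = isEquivalence
      ; irrefl        = λ _ ()
      ; trans         = λ ()
      ; <-resp-≈      = (λ _ ()) , (λ _ ())
      }
    ; compare = λ _ _ → tri≈ (λ ()) refl (λ ())
    }
  ; wellFounded        = λ _ → acc λ ()
  ; initial            = λ _ f → empty (proj₁ (Bijection.surjective f tt))
  }
  where
  empty : {A : Set} → ¬ ⟪ (λ (_ : A) → ⊥) ⟫
  empty (_ , [ () ])

ℵ₀ : Cardinal 0ℓ
ℵ₀ = record
  { Carrier            = ℕ
  ; _≺_                = _<_
  ; isStrictTotalOrder = ℕ.<-isStrictTotalOrder
  ; wellFounded        = <-wellFounded
  ; initial            = initial
  }
  where
  toFin : ∀ {n} → ⟪ _< n ⟫ → Fin n
  toFin (k , [ k<n ]) = fromℕ< (recompute (k ℕ.<? _) k<n)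

  toFin-injective : ∀ {n} {k l : ⟪ _< n ⟫} → toFin k ≡ toFin l → k ≡ l
  toFin-injective eq = value-injective (fromℕ<-injective _ _ _ _ eq)

  initial : ∀ n → ¬ (⟪ _< n ⟫ ⤖ ℕ)
  initial n f = contra (pigeonhole (ℕ.n<1+n n) (λ i → toFin (from (Fin.toℕ i))))
    where
    open Bijection f using (to; surjective)

    from : ℕ → ⟪ _< n ⟫
    from k = proj₁ (surjective k)

    to∘from : ∀ k → to (from k) ≡ k
    to∘from k = proj₂ (surjective k) refl

    contra : ¬ (∃[ i ] ∃[ j ] i Fin.< j ×
                toFin (from (Fin.toℕ i)) ≡ toFin (from (Fin.toℕ j)))
    contra (i , j , i<j , eq) = ℕ.<⇒≢ i<j
      (trans (sym (to∘from _))
        (trans (cong to (toFin-injective eq)) (to∘from _)))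

record MetricSpace a : Set (lsuc a) where
  field
    Carrier  : Set a
    dist     : DistanceFunction Carrier
    isMetric : IsMetric _≡_ dist

  open IsMetric isMetric public

subspace : (X : MetricSpace a) → Pred (MetricSpace.Carrier X) b →
           MetricSpace (a ⊔ℓ b)
subspace X L = record
  { Carrier  = ⟪ L ⟫
  ; dist     = λ x y → dist (value x) (value y)
  ; isMetric = record
    { isSemiMetric = record
      { isQuasiSemiMetric = record
        { isPreMetric = record
          { isProtoMetric = record
            { isPartialOrder  = ℕ.≤-isPartialOrder
            ; ≈-isEquivalence = isEquivalence
            ; cong            = cong₂ _
            ; nonNegative     = z≤n
            }
          ; ≈⇒0 = λ eq → ≈⇒0 (cong value eq)
          }
        ; 0⇒≈ = λ eq → value-injective (0⇒≈ eq)
        }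
      ; sym = λ x y → MetricSpace.sym X (value x) (value y)
      }
    ; triangle = λ x y z → triangle (value x) (value y) (value z)
    }
  }
  where open MetricSpace X using (dist; ≈⇒0; 0⇒≈; triangle)

module _ (X : MetricSpace a) where
  open MetricSpace X using (Carrier; dist)

  Ball : Carrier → ℕ → Pred Carrier 0ℓ
  Ball x m y = dist x y ≤ m

  Nbhd : Pred Carrier b → ℕ → Pred Carrier (a ⊔ℓ b)
  Nbhd L m y = ∃[ x ] x ∈ L × y ∈ Ball x m

  Bounded : Pred Carrier b → Set (a ⊔ℓ b)
  Bounded V = ∃[ x₀ ] ∃[ n ] V ⊆ Ball x₀ n

  Unbounded : Set a
  Unbounded = ¬ Bounded U

  Thin : Set (lsuc a)
  Thin = ∀ (m : ℕ) → ∃[ V ] Bounded {b = a} V ×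
           (∀ x → x ∉ V → Ball x m ≐ ｛ x ｝)

  Large : Pred Carrier b → Set (a ⊔ℓ b)
  Large L = ∃[ m ] Nbhd L m ≐ U

  IsAsymptoticDensity : Cardinal b → Set (lsuc a ⊔ℓ b)
  IsAsymptoticDensity = IsLeastCardinality Large

record Asymorphism (X₁ : MetricSpace a) (X₂ : MetricSpace b) :
                   Set (a ⊔ℓ b) where
  private
    module X₁ = MetricSpace X₁
    module X₂ = MetricSpace X₂
  field
    f         : X₁.Carrier → X₂.Carrier
    bijective : Bijective _≡_ _≡_ f
    c c′      : ℕ → ℕ
    expand    : ∀ n x y → X₁.dist x y ≤ n → X₂.dist (f x) (f y) < c n
    contract  : ∀ n x y → X₂.dist (f x) (f y) ≤ n → X₁.dist x y < c′ n

CoarselyEquivalent : MetricSpace a → MetricSpace b → Set (lsuc (a ⊔ℓ b))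
CoarselyEquivalent {a} {b} X₁ X₂ =
  Σ (Pred (MetricSpace.Carrier X₁) a) λ L₁ →
  Σ (Pred (MetricSpace.Carrier X₂) b) λ L₂ →
    Large X₁ L₁ × Large X₂ L₂ ×
    Asymorphism (subspace X₁ L₁) (subspace X₂ L₂)

-- T(κ₁, κ₂, …) is built on the disjoint union of its blocks; any other set
-- partitioned into blocks of these cardinalities gives an isometric space.
-- Indices start at 0, so that K i stands for κᵢ₊₁.

module _ (K : ℕ → Cardinal a) where
  Point : Set a
  Point = Σ ℕ λ i → ∣ K i ∣

  infix 4 _≟ᵀ_
  _≟ᵀ_ : DecidableEquality Point
  _≟ᵀ_ = Product.≡-dec ℕ._≟_ (λ {i} → Cardinal._≟_ (K i))

  ρ : Point → Point → ℕ
  ρ x@(i , _) y@(j , _) with x ≟ᵀ y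
  ... | yes _ = 0
  ... | no  _ = suc i ⊔ suc j

  ρ-refl : ∀ {x y} → x ≡ y → ρ x y ≡ 0
  ρ-refl {x} {y} x≡y with x ≟ᵀ y
  ... | yes _  = refl
  ... | no x≢y = ⊥-elim (x≢y x≡y)

  ρ-zero : ∀ {x y} → ρ x y ≡ 0 → x ≡ y
  ρ-zero {x} {y} _ with x ≟ᵀ y
  ρ-zero _  | yes x≡y = x≡y
  ρ-zero () | no _

  ρ-sym : ∀ x y → ρ x y ≡ ρ y x
  ρ-sym x@(i , _) y@(j , _) with x ≟ᵀ y | y ≟ᵀ x
  ... | yes _   | yes _   = refl
  ... | yes x≡y | no y≢x  = ⊥-elim (y≢x (sym x≡y))
  ... | no x≢y  | yes y≡x = ⊥-elim (x≢y (sym y≡x))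
  ... | no _    | no _    = ℕ.⊔-comm (suc i) (suc j)

  ρ-triangle : ∀ x y z → ρ x z ≤ ρ x y + ρ y z
  ρ-triangle x@(i , _) y@(j , _) z@(k , _) with x ≟ᵀ z | x ≟ᵀ y | y ≟ᵀ z
  ... | yes _  | _        | _        = z≤n
  ... | no x≢z | yes refl | yes refl = ⊥-elim (x≢z refl)
  ... | no _   | yes refl | no _     = ℕ.≤-refl
  ... | no _   | no _     | yes refl = ℕ.m≤m+n _ _
  ... | no _   | no _     | no _     =
    ℕ.⊔-lub
      (ℕ.≤-trans (ℕ.m≤m⊔n (suc i) (suc j)) (ℕ.m≤m+n _ _))
      (ℕ.≤-trans (ℕ.m≤n⊔m (suc j) (suc k))
        (ℕ.m≤n+m (suc j ⊔ suc k) (suc i ⊔ suc j)))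

  T : MetricSpace a
  T = record
    { Carrier  = Point
    ; dist     = ρ
    ; isMetric = record
      { isSemiMetric = record
        { isQuasiSemiMetric = record
          { isPreMetric = record
            { isProtoMetric = record
              { isPartialOrder  = ℕ.≤-isPartialOrder
              ; ≈-isEquivalence = isEquivalence
              ; cong            = cong₂ ρ
              ; nonNegative     = z≤n
              }
            ; ≈⇒0 = ρ-refl
            }
          ; 0⇒≈ = ρ-zero
          }
        ; sym = ρ-sym
        }
      ; triangle = ρ-triangle
      }
    }

{-# OPTIONS --safe #-}

-- Fix x₀ and let the height of x be its distance to x₀. Thinness says that
-- points at distance ≤ n are equal or both of height bounded in terms of n, so
-- a bijection onto T(κᵢ) is an asymorphism as soon as heights and layer
-- indices bound one another. The Cantor–Bernstein bijection agrees at each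
-- point with one of the two given injections or its inverse, hence it
-- suffices to have such injections both ways.
--
-- Every tail {height > N} is large, so it has cardinality κ. Call X wide if
-- beyond every height there is a bounded shell of cardinality κ; then X is
-- equivalent to T(κ, κ, …). Otherwise all shells of some tail are smaller
-- than κ. This is impossible when cf κ > ℵ₀, because a countable union of sets
-- injecting into one μ < κ is smaller than κ; when κ = ℵ₀ the shells are finite
-- and any bijection of the tail with ℕ is an asymorphism onto T(1, 1, …); and
-- when cf κ = ℵ₀ shells and blocks of T(κ′ₙ) inject into one another
-- arbitrarily far out.
module Submission where

open import Axiom.ExcludedMiddle using (ExcludedMiddle)
open import Data.Nat.Base using (ℕ; suc)
open import Data.Product using (_×_)
open import Data.Sum.Base using (_⊎_)
open import Function.Bundles using (_⤖_)
open import Function.Base using (const)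
open import Defs

open import Data.Empty using (⊥-elim)
open import Data.Irrelevant using ([_])
open import Data.Nat.Base using (zero; _+_; _*_; _≤_; _<_; _⊔_; z≤n; s≤s)
open import Data.Nat.GeneralisedArithmetic using (fold)
import Data.Nat.Properties as ℕ
open import Data.Product.Function.NonDependent.Propositional using (_×-↣_)
open import Data.Product using (∃; ∃-syntax; _,_; proj₁; proj₂)
open import Data.Product.Properties
  using (,-injective; ,-injectiveˡ; ,-injectiveʳ; ,-injectiveʳ-UIP)
open import Data.Refinement using (_,_; value; value-injective)
open import Data.Sum.Base using (inj₁; inj₂; [_,_]′)
open import Data.Unit.Base using (⊤; tt)
open import Function.Base using (_∘_; id; _on_)
open import Function.Bundles
  using (_↣_; mk↣; mk⤖; module Injection; module Bijection)
open import Function.Consequences.Propositional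
  using (strictlySurjective⇒surjective)
open import Function.Construct.Composition using (_↣-∘_)
open import Function.Construct.Identity using (↣-id)
open import Function.Definitions using (Bijective; Injective)
open import Induction.WellFounded using (WellFounded; Acc; acc)
open import Level using (Level; Lift; lift; lower)
  renaming (_⊔_ to _⊔ℓ_; suc to lsuc)
import Relation.Binary.Construct.On as On
open import Relation.Binary.Core using (Rel)
open import Relation.Binary.Definitions using (Tri; tri<; tri≈; tri>)
open import Relation.Binary.PropositionalEquality
  using (_≡_; _≢_; refl; sym; trans; cong; cong₂; subst; isEquivalence; resp₂)
open import Relation.Binary.Structures using (IsStrictTotalOrder)
open import Relation.Nullary using (¬_; Dec; yes; no; recompute; contradiction)
open import Relation.Nullary.Decidable using (decidable-stable)
open import Relation.Unary using (Pred)

private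
  variable
    a b c p : Level
    A : Set a
    B : Set b
    C : Set c

-- Injections, pairing of naturals, increasing sequences.

infixl 9 _⟨$⟩_
_⟨$⟩_ : A ↣ B → A → B
_⟨$⟩_ = Injection.to

infixr 8 _⨾_
_⨾_ : A ↣ B → B ↣ C → A ↣ C
f ⨾ g = g ↣-∘ f

⟪⟫-value : {P : Pred A p} → ⟪ P ⟫ ↣ A
⟪⟫-value = mk↣ value-injective

⤖⇒↣ : A ⤖ B → A ↣ B
⤖⇒↣ = Bijection.injection

⤖⇒↢ : A ⤖ B → B ↣ A
⤖⇒↢ f = mk↣ λ eq →
  trans (sym (proj₂ (strictlySurjective _))) (trans (cong to eq) (proj₂ (strictlySurjective _)))
  where open Bijection f using (to; strictlySurjective)

-- The code of `(m , n)` is 2^m (2n + 1); parity tells whether `m` is zero, and halving gives the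
-- induction.
ℕ×ℕ↣ℕ : (ℕ × ℕ) ↣ ℕ
ℕ×ℕ↣ℕ = mk↣ {to = λ { (m , n) → pair m n }} λ { {m , n} {m′ , n′} → injective m n m′ n′ }
  where
  pair : ℕ → ℕ → ℕ
  pair m n = fold (suc (2 * n)) (2 *_) m

  injective : ∀ m n m′ n′ → pair m n ≡ pair m′ n′ → (m , n) ≡ (m′ , n′)
  injective zero n zero n′ eq =
    cong (zero ,_) (ℕ.*-cancelˡ-≡ n n′ 2 (ℕ.suc-injective eq))
  injective zero n (suc m′) n′ eq = contradiction (sym eq) (ℕ.even≢odd (pair m′ n′) n)
  injective (suc m) n zero n′ eq = contradiction eq (ℕ.even≢odd (pair m n) n′)
  injective (suc m) n (suc m′) n′ eq = cong (λ { (k , l) → suc k , l })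
    (injective m n m′ n′ (ℕ.*-cancelˡ-≡ (pair m n) (pair m′ n′) 2 eq))

module _ {s : ℕ → ℕ} (s-< : ∀ n → s n < s (suc n)) where

  increasing : ∀ {m n} → m < n → s m < s n
  increasing {m} {suc n} (s≤s m≤n) with ℕ.m≤n⇒m<n∨m≡n m≤n
  ... | inj₁ m<n  = ℕ.<-trans (increasing m<n) (s-< n)
  ... | inj₂ refl = s-< n

  increasing⇒monotone : ∀ {m n} → m ≤ n → s m ≤ s n
  increasing⇒monotone m≤n with ℕ.m≤n⇒m<n∨m≡n m≤n
  ... | inj₁ m<n  = ℕ.<⇒≤ (increasing m<n)
  ... | inj₂ refl = ℕ.≤-refl

  increasing⇒injective : Injective _≡_ _≡_ s
  increasing⇒injective {m} {n} eq with ℕ.<-cmp m n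
  ... | tri< m<n _ _ = contradiction eq (ℕ.<⇒≢ (increasing m<n))
  ... | tri≈ _ m≡n _ = m≡n
  ... | tri> _ _ n<m = contradiction (sym eq) (ℕ.<⇒≢ (increasing n<m))

  increasing⇒≥ : ∀ n → n ≤ s n
  increasing⇒≥ zero    = z≤n
  increasing⇒≥ (suc n) = ℕ.≤-<-trans (increasing⇒≥ n) (s-< n)

-- Well-orders and isomorphism of their initial segments.

record WellOrder (A : Set a) : Set (lsuc a) where
  infix 4 _≺_
  field
    _≺_                : Rel A a
    isStrictTotalOrder : IsStrictTotalOrder _≡_ _≺_
    isWellFounded      : WellFounded _≺_

  open IsStrictTotalOrder isStrictTotalOrder public
    using (compare) renaming (trans to ≺-trans)

  Segment : A → Set a
  Segment x = ⟪ _≺ x ⟫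

  irrefl : ∀ {x} → ¬ (x ≺ x)
  irrefl = IsStrictTotalOrder.irrefl isStrictTotalOrder refl

wellOrder : (κ : Cardinal a) → WellOrder ∣ κ ∣
wellOrder κ = record
  { _≺_                = _≺_
  ; isStrictTotalOrder = isStrictTotalOrder
  ; isWellFounded      = wellFounded
  }
  where open Cardinal κ

-- Initiality is left out of `WellOrder` because it need not survive passing to subsets, whereas
-- well-ordering does.
pullback : {A B : Set a} → A ↣ B → WellOrder B → WellOrder A
pullback f W = record
  { _≺_                = _≺_ on to
  ; isStrictTotalOrder = record
    { isStrictPartialOrder = record
      { isEquivalence = isEquivalence
      ; irrefl        = λ { refl → irrefl }
      ; trans         = ≺-trans
      ; <-resp-≈      = resp₂ _
      }
    ; compare = λ x y → cmp (compare (to x) (to y))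
    }
  ; isWellFounded      = On.wellFounded to isWellFounded
  }
  where
  open Injection f using (to; injective)
  open WellOrder W

  cmp : ∀ {x y} → Tri (to x ≺ to y) (to x ≡ to y) (to y ≺ to x) →
        Tri (to x ≺ to y) (x ≡ y) (to y ≺ to x)
  cmp (tri< p q r) = tri< p (q ∘ cong to) r
  cmp (tri≈ p q r) = tri≈ p (injective q) r
  cmp (tri> p q r) = tri> p (q ∘ cong to) r

module Order {A : Set a} (W : WellOrder A) {B : Set b} (V : WellOrder B) where
  private
    module W = WellOrder W
    module V = WellOrder V

  -- The initial segments below x and y are isomorphic.
  data Matches (x : A) (y : B) : Set (a ⊔ℓ b) where
    matches :
      (∀ x′ → x′ W.≺ x → ∃[ y′ ] y′ V.≺ y × Matches x′ y′) →
      (∀ y′ → y′ V.≺ y → ∃[ x′ ] x′ W.≺ x × Matches x′ y′) →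
      Matches x y

  -- If `y ≺ y′`, then `y` has a mate `x₁ ≺ x`, which is also matched with some `y₁ ≺ y`; induction
  -- at `x₁` forces `y₁ ≡ y`.
  functional : ∀ {x y y′} → Matches x y → Matches x y′ → y ≡ y′
  functional = go (W.isWellFounded _)
    where
    go : ∀ {x y y′} → Acc W._≺_ x → Matches x y → Matches x y′ → y ≡ y′
    go {y = y} {y′} (acc rec) (matches f g) (matches f′ g′) with V.compare y y′
    ... | tri≈ _ y≡y′ _ = y≡y′
    ... | tri< y≺y′ _ _ =
      let x₁ , x₁≺x , m = g′ y y≺y′
          y₁ , y₁≺y , n = f x₁ x₁≺x
      in contradiction (subst (V._≺ y) (go (rec x₁≺x) n m) y₁≺y) V.irrefl
    ... | tri> _ _ y′≺y =
      let x₁ , x₁≺x , m = g y′ y′≺y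
          y₁ , y₁≺y′ , n = f′ x₁ x₁≺x
      in contradiction (subst (V._≺ y′) (go (rec x₁≺x) n m) y₁≺y′) V.irrefl

  injective : ∀ {x x′ y} → Matches x y → Matches x′ y → x ≡ x′
  injective = go (V.isWellFounded _)
    where
    go : ∀ {x x′ y} → Acc V._≺_ y → Matches x y → Matches x′ y → x ≡ x′
    go {x} {x′} (acc rec) (matches f g) (matches f′ g′) with W.compare x x′
    ... | tri≈ _ x≡x′ _ = x≡x′
    ... | tri< x≺x′ _ _ =
      let y₁ , y₁≺y , m = f′ x x≺x′
          x₁ , x₁≺x , n = g y₁ y₁≺y
      in contradiction (subst (W._≺ x) (go (rec y₁≺y) n m) x₁≺x) W.irrefl
    ... | tri> _ _ x′≺x =
      let y₁ , y₁≺y , m = f x′ x′≺x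
          x₁ , x₁≺x′ , n = g′ y₁ y₁≺y
      in contradiction (subst (W._≺ x′) (go (rec y₁≺y) n m) x₁≺x′) W.irrefl

-- Excluded middle and the Cantor-Bernstein bijection.

module Classical (em : ∀ {ℓ} → ExcludedMiddle ℓ) where

  byContradiction : ¬ ¬ A → A
  byContradiction = decidable-stable em

  ∀⊎∃¬ : (P : Pred A p) → (∀ x → P x) ⊎ (∃[ x ] ¬ P x)
  ∀⊎∃¬ P with em {P = ∃[ x ] ¬ P x}
  ... | yes ∃¬ = inj₂ ∃¬
  ... | no ¬∃¬ = inj₁ λ x → byContradiction λ ¬Px → ¬∃¬ (x , ¬Px)

  -- The stored proof is irrelevant, but excluded middle decides `P`, which lets a usable proof be
  -- recovered.
  holds : {P : Pred A p} (x : ⟪ P ⟫) → P (value x)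
  holds (_ , [ Px ]) = recompute em Px

  module Bernstein {a b} {A : Set a} {B : Set b} (f : A ↣ B) (g : B ↣ A) where
    private
      module F = Injection f
      module G = Injection g

    -- The points whose backward orbit under `g` and `f` stops in `A`, outside the image of `g`. The
    -- bijection is `f` on them and the inverse of `g` elsewhere.
    data Chain : A → Set (a ⊔ℓ b) where
      start : ∀ {x} → ¬ (∃[ y ] G.to y ≡ x) → Chain x
      next  : ∀ {x} → Chain x → Chain (G.to (F.to x))

    ¬Chain⇒image : ∀ {x} → ¬ Chain x → ∃[ y ] G.to y ≡ x
    ¬Chain⇒image ¬c = byContradiction (¬c ∘ start)

    -- The decision is a separate argument so that `surjective` can rewrite along the equation for
    -- `em`.
    to-dec : ∀ x → Dec (Chain x) → B
    to-dec x (yes _) = F.to x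
    to-dec x (no ¬c) = proj₁ (¬Chain⇒image ¬c)

    to : A → B
    to x = to-dec x em

    to-cases : ∀ x → to x ≡ F.to x ⊎ G.to (to x) ≡ x
    to-cases x with em {P = Chain x}
    ... | yes _ = inj₁ refl
    ... | no ¬c = inj₂ (proj₂ (¬Chain⇒image ¬c))

    injective : Injective _≡_ _≡_ to
    injective {x} {y} eq with em {P = Chain x} | em {P = Chain y}
    ... | yes _ | yes _ = F.injective eq
    ... | yes c | no ¬d = contradiction
      (subst Chain (trans (cong G.to eq) (proj₂ (¬Chain⇒image ¬d))) (next c)) ¬d
    ... | no ¬c | yes d = contradiction
      (subst Chain (trans (cong G.to (sym eq)) (proj₂ (¬Chain⇒image ¬c))) (next d)) ¬c
    ... | no ¬c | no ¬d =
      trans (sym (proj₂ (¬Chain⇒image ¬c)))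
        (trans (cong G.to eq) (proj₂ (¬Chain⇒image ¬d)))

    Chain⇒preimage : ∀ {x} y → Chain x → G.to y ≡ x → ∃[ z ] Chain z × F.to z ≡ y
    Chain⇒preimage y (start ¬im)  eq = contradiction (y , eq) ¬im
    Chain⇒preimage y (next {z} c) eq = z , c , sym (G.injective eq)

    -- Off the chain, `G.to y` itself is sent to `y`. On it, `G.to y` cannot be a starting point, so
    -- its predecessor on the chain is sent to `y` by `f`.
    surjective : ∀ y → ∃[ x ] to x ≡ y
    surjective y with em {P = Chain (G.to y)} in eq
    ... | no ¬c = G.to y ,
      trans (cong (to-dec _) eq) (G.injective (proj₂ (¬Chain⇒image ¬c)))
    ... | yes c with Chain⇒preimage y c refl
    ...   | z , d , Fz≡y with em {P = Chain z} in eq′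
    ...     | yes _ = z , trans (cong (to-dec z) eq′) Fz≡y
    ...     | no ¬d = contradiction d ¬d

    bijective : Bijective _≡_ _≡_ to
    bijective = injective , strictlySurjective⇒surjective surjective

  bernstein : A ↣ B → B ↣ A → A ⤖ B
  bernstein f g = mk⤖ (Bernstein.bijective f g)

  -- Comparability of well-ordered sets and existence of cardinalities.

  least : (W : WellOrder A) (P : Pred A p) → ∃ P →
          ∃[ x ] P x × (∀ y → WellOrder._≺_ W y x → ¬ P y)
  least W P (x , Px) = go (isWellFounded x) Px
    where
    open WellOrder W

    go : ∀ {x} → Acc _≺_ x → P x → ∃[ x ] P x × (∀ y → y ≺ x → ¬ P y)
    go {x} (acc rec) Px with em {P = ∃[ y ] y ≺ x × P y}
    ... | yes (y , y≺x , Py) = go (rec y≺x) Py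
    ... | no ¬smaller        = x , Px , λ y y≺x Py → ¬smaller (y , y≺x , Py)

  -- If all of `B` is matched, matching embeds `B` into `A`. Otherwise all of `A` is matched below
  -- the least unmatched `y`.
  comparable : WellOrder A → (V : WellOrder B) →
               (B ↣ A) ⊎ (∃[ y ] A ↣ WellOrder.Segment V y)
  comparable {A = A} {B = B} W V with ∀⊎∃¬ (λ y → ∃[ x ] Order.Matches W V x y)
  ... | inj₁ all = inj₁ (mk↣ λ {y} {y′} eq → functional (proj₂ (all y))
          (subst (λ x → Matches x y′) (sym eq) (proj₂ (all y′))))
    where open Order W V
  ... | inj₂ unmatched = inj₂ (y , f)
    where
    open Order W V
    module W = WellOrder W
    module V = WellOrder V

    leastUnmatched = least V _ unmatched
    y  = proj₁ leastUnmatched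
    ¬y = proj₁ (proj₂ leastUnmatched)

    below : ∀ {x′ y′} → Matches x′ y′ → y′ V.≺ y
    below {x′} {y′} m@(matches _ g) with V.compare y′ y
    ... | tri< y′≺y _ _ = y′≺y
    ... | tri≈ _ refl _ = contradiction (x′ , m) ¬y
    ... | tri> _ _ y≺y′ = let x₁ , _ , n = g y y≺y′ in contradiction (x₁ , n) ¬y

    image : ∀ x → ∃[ y′ ] Matches x y′
    image with ∀⊎∃¬ (λ x → ∃[ y′ ] Matches x y′)
    ... | inj₁ all = all
    -- The least unmatched elements of both sides would match each other.
    ... | inj₂ unmatchedˡ = contradiction (x , matches forth back) ¬y
      where
      leastUnmatchedˡ = least W _ unmatchedˡ
      x  = proj₁ leastUnmatchedˡ
      ¬x = proj₁ (proj₂ leastUnmatchedˡ)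

      belowˡ : ∀ {x′ y′} → Matches x′ y′ → x′ W.≺ x
      belowˡ {x′} {y′} m@(matches f _) with W.compare x′ x
      ... | tri< x′≺x _ _ = x′≺x
      ... | tri≈ _ refl _ = contradiction (y′ , m) ¬x
      ... | tri> _ _ x≺x′ = let y₁ , _ , n = f x x≺x′ in contradiction (y₁ , n) ¬x

      forth : ∀ x′ → x′ W.≺ x → ∃[ y′ ] y′ V.≺ y × Matches x′ y′
      forth x′ x′≺x =
        let y′ , m = byContradiction (proj₂ (proj₂ leastUnmatchedˡ) x′ x′≺x)
        in y′ , below m , m

      back : ∀ y′ → y′ V.≺ y → ∃[ x′ ] x′ W.≺ x × Matches x′ y′
      back y′ y′≺y =
        let x′ , m = byContradiction (proj₂ (proj₂ leastUnmatched) y′ y′≺y)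
        in x′ , belowˡ m , m

    f : A ↣ V.Segment y
    f = mk↣ {to = λ x → proj₁ (image x) , [ below (proj₂ (image x)) ]} λ {x} {x′} eq →
      injective (proj₂ (image x))
        (subst (Matches x′) (sym (cong value eq)) (proj₂ (image x′)))

  asCardinal : (W : WellOrder A) →
               (∀ x → ¬ (A ↣ WellOrder.Segment W x)) → Cardinal _
  asCardinal {A = A} W initial = record
    { Carrier            = A
    ; _≺_                = _≺_
    ; isStrictTotalOrder = isStrictTotalOrder
    ; wellFounded        = isWellFounded
    ; initial            = λ x bij → initial x (⤖⇒↢ bij)
    }
    where open WellOrder W

  -- The least segment into which `A` injects is an initial ordinal; if there is no such segment,
  -- `A` itself is one.
  cardinality : {A : Set a} → WellOrder A →
                ∃[ μ ] (∣_∣ {a} μ ↣ A) × (A ↣ ∣ μ ∣)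
  cardinality {A = A} W with em {P = ∃[ x ] A ↣ WellOrder.Segment W x }
  ... | no ¬small = asCardinal W (λ x f → ¬small (x , f)) , ↣-id _ , ↣-id _
  ... | yes small =
    asCardinal (pullback ⟪⟫-value W) minimal , ⟪⟫-value , proj₁ (proj₂ smallest)
    where
    open WellOrder W
    smallest = least W _ small
    x = proj₁ smallest

    minimal : (y : Segment x) → ¬ (Segment x ↣ ⟪ (λ z → value z ≺ value y) ⟫)
    minimal y g = proj₂ (proj₂ smallest) (value y) (holds y)
      (proj₁ (proj₂ smallest) ⨾ g ⨾ flatten)
      where
      flatten : ⟪ (λ (z : Segment x) → value z ≺ value y) ⟫ ↣ Segment (value y)
      flatten = mk↣ {to = λ { (z , p) → value z , p }} λ eq →
        value-injective (value-injective (cong value eq))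

  -- Together with the inclusion, such an injection would give a bijection by Cantor-Bernstein.
  ¬↣initial : (κ : Cardinal a) (x : ∣ κ ∣) →
              ¬ (∣ κ ∣ ↣ WellOrder.Segment (wellOrder κ) x)
  ¬↣initial κ x f = Cardinal.initial κ x (bernstein ⟪⟫-value f)

  -- Infinite cardinals absorb a countable factor.

  enumerationFrom : ℕ ↣ A → (x : A) → ∃[ s ] _⟨$⟩_ {A = ℕ} s 0 ≡ x
  enumerationFrom {A = A} e x with em {P = ∃[ k ] e ⟨$⟩ k ≡ x}
  ... | yes (k , eq) = mk↣ {to = λ n → e ⟨$⟩ (k + n)}
          (λ {m} {n} → ℕ.+-cancelˡ-≡ k m n ∘ Injection.injective e) ,
        trans (cong (e ⟨$⟩_) (ℕ.+-identityʳ k)) eq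
  ... | no x∉e = mk↣ {to = s} (λ {m} {n} → injective m n) , refl
    where
    s : ℕ → A
    s zero    = x
    s (suc n) = e ⟨$⟩ n

    injective : ∀ m n → s m ≡ s n → m ≡ n
    injective zero    zero    _  = refl
    injective zero    (suc n) eq = contradiction (n , sym eq) x∉e
    injective (suc m) zero    eq = contradiction (m , eq) x∉e
    injective (suc m) (suc n) eq = cong suc (Injection.injective e eq)

  -- Hilbert's hotel.
  evacuate : ℕ ↣ A → (x : A) → ∃[ h ] (∀ y → _⟨$⟩_ {A = A} h y ≢ x)
  evacuate {A = A} e x = mk↣ {to = λ y → h y em} (injective em em) , λ y → avoids y em
    where
    s = proj₁ (enumerationFrom e x)
    s0≡x = proj₂ (enumerationFrom e x)

    h : ∀ y → Dec (∃[ n ] s ⟨$⟩ n ≡ y) → A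
    h y (yes (n , _)) = s ⟨$⟩ suc n
    h y (no _)        = y

    injective : ∀ {y z} y? z? → h y y? ≡ h z z? → y ≡ z
    injective (yes (m , p)) (yes (n , q)) eq =
      trans (sym p) (trans (cong (s ⟨$⟩_) (ℕ.suc-injective (Injection.injective s eq))) q)
    injective (yes (m , _)) (no z∉s) eq = contradiction (suc m , eq) z∉s
    injective (no y∉s) (yes (n , _)) eq = contradiction (suc n , sym eq) y∉s
    injective (no _)   (no _)        eq = eq

    avoids : ∀ y y? → h y y? ≢ x
    avoids y (yes _) eq with () ← Injection.injective s (trans eq (sym s0≡x))
    avoids y (no y∉s) eq = y∉s (0 , trans s0≡x (sym eq))

  module Infinite (κ : Cardinal a) (e : ℕ ↣ ∣ κ ∣) where
    open WellOrder (wellOrder κ)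

    -- If `x` were the maximum, a self-injection avoiding `x` would embed κ into the segment below
    -- `x`.
    unboundedAbove : ∀ x → ∃[ y ] x ≺ y
    unboundedAbove x = byContradiction λ x-max →
      ¬↣initial κ x (mk↣ {to = λ y → h ⟨$⟩ y , [ below x-max y ]}
        λ eq → Injection.injective h (cong value eq))
      where
      h = proj₁ (evacuate e x)

      below : ¬ (∃[ y ] x ≺ y) → ∀ y → h ⟨$⟩ y ≺ x
      below x-max y with compare (h ⟨$⟩ y) x
      ... | tri< hy≺x _ _ = hy≺x
      ... | tri≈ _ hy≡x _ = contradiction hy≡x (proj₂ (evacuate e x) y)
      ... | tri> _ _ x≺hy = contradiction (_ , x≺hy) x-max

    leastAbove : ∀ x → ∃[ y ] x ≺ y × (∀ z → z ≺ y → ¬ (x ≺ z))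
    leastAbove x = least (wellOrder κ) (x ≺_) (unboundedAbove x)

    next : ∣ κ ∣ → ∣ κ ∣
    next = proj₁ ∘ leastAbove

    x≺next : ∀ x → x ≺ next x
    x≺next = proj₁ ∘ proj₂ ∘ leastAbove

    next-≮ : ∀ {x y} → x ≺ y → next x ≢ next y
    next-≮ {x} {y} x≺y eq =
      proj₂ (proj₂ (leastAbove x)) y (subst (y ≺_) (sym eq) (x≺next y)) x≺y

    next-injective : Injective _≡_ _≡_ next
    next-injective {x} {y} eq with compare x y
    ... | tri< x≺y _ _ = contradiction eq (next-≮ x≺y)
    ... | tri≈ _ x≡y _ = x≡y
    ... | tri> _ _ y≺x = contradiction (sym eq) (next-≮ y≺x)

    -- The least element counts as a limit.
    IsLimit : Pred ∣ κ ∣ a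
    IsLimit l = ∀ x → next x ≢ l

    _⊹_ : ∣ κ ∣ → ℕ → ∣ κ ∣
    _⊹_ l = fold l next

    decompose : ∀ x → ∃[ l ] ∃[ n ] IsLimit l × l ⊹ n ≡ x
    decompose x = go (isWellFounded x)
      where
      go : ∀ {x} → Acc _≺_ x → ∃[ l ] ∃[ n ] IsLimit l × l ⊹ n ≡ x
      go {x} (acc rec) with em {P = ∃[ y ] next y ≡ x}
      ... | no ¬succ = x , 0 , (λ y eq → ¬succ (y , eq)) , refl
      ... | yes (y , refl) =
        let l , n , lim , eq = go (rec (x≺next y)) in l , suc n , lim , cong next eq

    ⊹-injective : ∀ {l l′} m n → IsLimit l → IsLimit l′ →
                  l ⊹ m ≡ l′ ⊹ n → l ≡ l′ × m ≡ n
    ⊹-injective zero    zero    _ _   eq = eq , refl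
    ⊹-injective zero    (suc n) lim _ eq = contradiction (sym eq) (lim _)
    ⊹-injective (suc m) zero    _ lim eq = contradiction eq (lim _)
    ⊹-injective (suc m) (suc n) lim lim′ eq =
      let l≡l′ , m≡n = ⊹-injective m n lim lim′ (next-injective eq)
      in l≡l′ , cong suc m≡n

    -- Every element is l ⊹ n for a unique limit l, so ℕ × κ embeds into
    -- (ℕ × ℕ) × limits, and the two natural numbers can be paired.
    ℕ×κ↣κ : (ℕ × ∣ κ ∣) ↣ ∣ κ ∣
    ℕ×κ↣κ = mk↣ {to = to} λ { {k , x} {k′ , x′} → injective k x k′ x′ }
      where
      limit : ∣ κ ∣ → ∣ κ ∣
      limit x = proj₁ (decompose x)

      offset : ∣ κ ∣ → ℕ
      offset x = proj₁ (proj₂ (decompose x))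

      isLimit : ∀ x → IsLimit (limit x)
      isLimit x = proj₁ (proj₂ (proj₂ (decompose x)))

      recompose : ∀ x → limit x ⊹ offset x ≡ x
      recompose x = proj₂ (proj₂ (proj₂ (decompose x)))

      to : ℕ × ∣ κ ∣ → ∣ κ ∣
      to (k , x) = limit x ⊹ (ℕ×ℕ↣ℕ ⟨$⟩ (k , offset x))

      injective : ∀ k x k′ x′ → to (k , x) ≡ to (k′ , x′) → (k , x) ≡ (k′ , x′)
      injective k x k′ x′ eq =
        let l≡l′ , p≡p′ = ⊹-injective _ _ (isLimit x) (isLimit x′) eq
            k≡k′ , n≡n′ = ,-injective
              (Injection.injective ℕ×ℕ↣ℕ {k , offset x} {k′ , offset x′} p≡p′)
        in cong₂ _,_ k≡k′
             (trans (sym (recompose x)) (trans (cong₂ _⊹_ l≡l′ n≡n′) (recompose x′)))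

  -- An infinite `A` absorbs the factor ℕ. A finite one would make ℕ × `A`, and hence κ, countable.
  uncountable↣ℕ×⇒↣ : {A : Set a} (κ : Cardinal b) → ¬ (∣ κ ∣ ↣ ℕ) → WellOrder A →
                     ∣ κ ∣ ↣ (ℕ × A) → ∣ κ ∣ ↣ A
  uncountable↣ℕ×⇒↣ κ κ≰ℕ W f with cardinality W
  ... | μ , μ↣A , A↣μ with comparable (wellOrder μ) (wellOrder ℵ₀)
  ...   | inj₁ ℕ↣μ = f ⨾ (↣-id ℕ ×-↣ A↣μ) ⨾ Infinite.ℕ×κ↣κ μ ℕ↣μ ⨾ μ↣A
  ...   | inj₂ (n , μ↣n) = contradiction
            (f ⨾ (↣-id ℕ ×-↣ (A↣μ ⨾ μ↣n ⨾ ⟪⟫-value)) ⨾ ℕ×ℕ↣ℕ) κ≰ℕ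

  comparable′ : WellOrder A → WellOrder B → (B ↣ A) ⊎ (A ↣ B)
  comparable′ W V with comparable W V
  ... | inj₁ B↣A       = inj₁ B↣A
  ... | inj₂ (_ , A↣y) = inj₂ (A↣y ⨾ ⟪⟫-value)

  -- Bounds between functions to ℕ, and the metric of `T`.

  Controls : (A → ℕ) → (A → ℕ) → Set _
  Controls u v = ∀ n → ∃[ c ] ∀ x → u x ≤ n → v x ≤ c

  -- Choosing each point above the value at the previous one makes the values increase, so the
  -- points are distinct.
  unbounded⇒ℕ↣ : (f : A → ℕ) → (∀ c → ∃[ x ] c < f x) → ℕ ↣ A
  unbounded⇒ℕ↣ {A = A} f above = mk↣ {to = s} λ {m} {n} eq →
    increasing⇒injective (λ k → proj₂ (above (f (s k)))) (cong f eq)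
    where
    s : ℕ → A
    s zero    = proj₁ (above 0)
    s (suc n) = proj₁ (above (f (s n)))

  finite⇒bounded : (g : ℕ → ℕ) → ∀ n → ∃[ c ] ∀ k → k ≤ n → g k ≤ c
  finite⇒bounded g zero = g 0 , λ { zero z≤n → ℕ.≤-refl }
  finite⇒bounded g (suc n) with finite⇒bounded g n
  ... | c , bound = c ⊔ g (suc n) , λ k k≤1+n → go k (ℕ.m≤n⇒m<n∨m≡n k≤1+n)
    where
    go : ∀ k → k < suc n ⊎ k ≡ suc n → g k ≤ c ⊔ g (suc n)
    go k (inj₁ (s≤s k≤n)) = ℕ.m≤n⇒m≤n⊔o _ (bound k k≤n)
    go k (inj₂ refl)      = ℕ.m≤n⊔m c _

  module _ (K : ℕ → Cardinal b) where

    ρ≤ : ∀ x y → ρ K x y ≤ suc (proj₁ x ⊔ proj₁ y)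
    ρ≤ x y with _≟ᵀ_ K x y
    ... | yes _ = z≤n
    ... | no  _ = ℕ.≤-refl

    layer≤ρ : ∀ {x y} → x ≢ y → proj₁ x ≤ ρ K x y × proj₁ y ≤ ρ K x y
    layer≤ρ {x} {y} x≢y with _≟ᵀ_ K x y
    ... | yes x≡y = contradiction x≡y x≢y
    ... | no  _   = ℕ.m≤n⇒m≤1+n (ℕ.m≤m⊔n _ _) , ℕ.m≤n⇒m≤1+n (ℕ.m≤n⊔m (proj₁ x) _)

  -- Heights, tails and shells of a thin space.

  module Layered (X : MetricSpace a) (x₀ : MetricSpace.Carrier X)
                 (unbounded : Unbounded X) (thin : Thin X) where
    open MetricSpace X using (Carrier; dist; triangle; ≈⇒0) renaming (sym to dist-sym)

    height : Carrier → ℕ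
    height = dist x₀

    -- Lifted because asymptotic density and coarse equivalence range over predicates at the level
    -- of the carrier.
    Outside : ℕ → Pred Carrier a
    Outside N x = Lift a (N < height x)

    Tail : ℕ → Set a
    Tail N = ⟪ Outside N ⟫

    Shell : ℕ → ℕ → Set a
    Shell N m = ⟪ (λ x → N < height x × height x ≤ m) ⟫

    Shell⊆Tail : ∀ {N m} → Shell N m → Tail N
    Shell⊆Tail (x , [ p ]) = x , [ lift (proj₁ p) ]

    Tail⊆Shell : ∀ {N m} (x : Tail N) → height (value x) ≤ m → Shell N m
    Tail⊆Shell x hx≤m = value x , [ lower (holds x) , hx≤m ]

    -- By unboundedness some `y` has height above `N`; every point of height at most `N` is within
    -- `height y + N` of it.
    Outside-large : ∀ N → Large X (Outside N)
    Outside-large N with ∀⊎∃¬ (λ x → height x ≤ N)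
    ... | inj₁ all≤N = contradiction (x₀ , N , λ {x} _ → all≤N x) unbounded
    ... | inj₂ (y , hy≰N) = height y + N , (λ _ → tt) ,
            λ {x} _ → near x (ℕ.≤-<-connex (height x) N)
      where
      near : ∀ x → height x ≤ N ⊎ N < height x → Nbhd X (Outside N) (height y + N) x
      near x (inj₁ hx≤N) = y , lift (ℕ.≰⇒> hy≰N) ,
        ℕ.≤-trans (triangle y x₀ x)
          (ℕ.+-mono-≤ (ℕ.≤-reflexive (dist-sym y x₀)) hx≤N)
      near x (inj₂ N<hx) = x , lift N<hx , ℕ.≤-trans (ℕ.≤-reflexive (≈⇒0 refl)) z≤n

    -- A point with another point within `m` must lie in the bounded exceptional set that thinness
    -- provides for `m`.
    isolation : ∀ m → ∃[ r ] ∀ x y → x ≢ y → dist x y ≤ m → height x ≤ r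
    isolation m with thin m
    ... | V , (x₁ , n , V⊆) , isolated = dist x₀ x₁ + n , λ x y x≢y d≤m →
      ℕ.≤-trans (triangle x₀ x₁ x) (ℕ.+-monoʳ-≤ (dist x₀ x₁)
        (V⊆ (byContradiction λ x∉V → x≢y (proj₁ (isolated x x∉V) d≤m))))

    module _ (K : ℕ → Cardinal b) (N : ℕ) (h : Tail N → Point K)
             (h-bijective : Bijective _≡_ _≡_ h) where

      coarselyEquivalent : Controls (height ∘ value) (proj₁ ∘ h) →
                           Controls (proj₁ ∘ h) (height ∘ value) →
                           CoarselyEquivalent X (T K)
      coarselyEquivalent up down =
        Outside N , (λ _ → Lift _ ⊤) , Outside-large N ,
        (0 , (λ _ → tt) , λ {x} _ → x , lift tt , ℕ.≤-reflexive (ρ-refl K {x} refl)) ,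
        record
          { f         = λ x → h x , [ lift tt ]
          ; bijective = (λ eq → proj₁ h-bijective (cong value eq)) ,
                        strictlySurjective⇒surjective λ y →
                          let x , hx≡ = proj₂ h-bijective (value y)
                          in x , value-injective (hx≡ refl)
          -- One successor comes from ρ being one more than the larger layer index, the other from
          -- the strict inequality.
          ; c         = λ n → suc (suc (proj₁ (up (radius n))))
          ; c′        = λ n → suc (proj₁ (down n) + proj₁ (down n))
          ; expand    = λ n x y d≤n → s≤s (expand n x y d≤n em)
          ; contract  = λ n x y d≤n → s≤s (contract n x y d≤n em)
          }
        where
        radius : ℕ → ℕ
        radius n = proj₁ (isolation n)

        expand : ∀ n x y → dist (value x) (value y) ≤ n → Dec (x ≡ y) →
                 ρ K (h x) (h y) ≤ suc (proj₁ (up (radius n)))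
        expand n x y d≤n (yes x≡y) =
          ℕ.≤-trans (ℕ.≤-reflexive (ρ-refl K (cong h x≡y))) z≤n
        expand n x y d≤n (no x≢y) = ℕ.≤-trans (ρ≤ K (h x) (h y)) (s≤s (ℕ.⊔-lub
          (bound x (proj₂ (isolation n) _ _ (x≢y ∘ value-injective) d≤n))
          (bound y (proj₂ (isolation n) _ _ (x≢y ∘ sym ∘ value-injective)
            (ℕ.≤-trans (ℕ.≤-reflexive (dist-sym _ _)) d≤n)))))
          where bound = proj₂ (up (radius n))

        contract : ∀ n x y → ρ K (h x) (h y) ≤ n → Dec (x ≡ y) →
                   dist (value x) (value y) ≤ proj₁ (down n) + proj₁ (down n)
        contract n x y ρ≤n (yes x≡y) =
          ℕ.≤-trans (ℕ.≤-reflexive (≈⇒0 (cong value x≡y))) z≤n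
        contract n x y ρ≤n (no x≢y) =
          let i≤ρ , j≤ρ = layer≤ρ K (x≢y ∘ proj₁ h-bijective)
              bound = proj₂ (down n)
          in ℕ.≤-trans (triangle (value x) x₀ (value y)) (ℕ.+-mono-≤
               (ℕ.≤-trans (ℕ.≤-reflexive (dist-sym _ _)) (bound x (ℕ.≤-trans i≤ρ ρ≤n)))
               (bound y (ℕ.≤-trans j≤ρ ρ≤n)))

    -- Interleaving shells with blocks.

    module Interleave
      (K : ℕ → Cardinal b) (n₀ : ℕ)
      (outer : ∀ N n → ∃[ m ] ∣ K n ∣ ↣ Shell N m)
      (inner : ∀ j N → ∃[ n ] N ≤ n × (Shell n₀ j ↣ ∣ K n ∣)) where

      private
        -- The lower bound `N` is stored with the chosen block so that `ν-<` is a mere projection.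
        slot : ∀ j → ∃[ n ] ∃[ N ] N ≤ n × (Shell n₀ j ↣ ∣ K n ∣)
        slot zero    = proj₁ (inner 0 0) , 0 , proj₂ (inner 0 0)
        slot (suc j) = proj₁ (inner (suc j) N) , N , proj₂ (inner (suc j) N)
          where N = suc (proj₁ (slot j))

        ν : ℕ → ℕ
        ν j = proj₁ (slot j)

        φ : ∀ j → Shell n₀ j ↣ ∣ K (ν j) ∣
        φ j = proj₂ (proj₂ (proj₂ (slot j)))

        ν-< : ∀ j → ν j < ν (suc j)
        ν-< j = proj₁ (proj₂ (proj₂ (slot (suc j))))

        edge : ℕ → ℕ
        edge zero    = n₀
        -- The maximum keeps the edges strictly increasing even when block `n` is empty and `outer`
        -- gives no usable radius.
        edge (suc n) = proj₁ (outer (edge n) n) ⊔ suc (edge n)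

        edge-< : ∀ n → edge n < edge (suc n)
        edge-< n = ℕ.m≤n⊔m (proj₁ (outer (edge n) n)) _

        ψ : ∀ n → ∣ K n ∣ ↣ Shell (edge n) (proj₁ (outer (edge n) n))
        ψ n = proj₂ (outer (edge n) n)

      f : Tail n₀ ↣ Point K
      -- Only points of height exactly `j` enter block `ν j`, so different heights land in different
      -- blocks.
      f = mk↣ {to = λ x → ν (height (value x)) , φ _ ⟨$⟩ shell x}
        λ {x} {y} eq → value-injective (injective _ _ (shell x) (shell y) eq)
        where
        shell : (x : Tail n₀) → Shell n₀ (height (value x))
        shell x = Tail⊆Shell x ℕ.≤-refl

        injective : ∀ j j′ (s : Shell n₀ j) (t : Shell n₀ j′) →
                    _≡_ {A = Point K} (ν j , φ j ⟨$⟩ s) (ν j′ , φ j′ ⟨$⟩ t) →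
                    value s ≡ value t
        injective j j′ s t eq with increasing⇒injective ν-< {j} {j′} (,-injectiveˡ eq)
        ... | refl = cong value (Injection.injective (φ j)
                       (,-injectiveʳ-UIP ℕ.≡-irrelevant eq))

      g-height : ((n , w) : Point K) → edge n < height (value (ψ n ⟨$⟩ w)) ×
                                       height (value (ψ n ⟨$⟩ w)) ≤ edge (suc n)
      g-height (n , w) = proj₁ (holds (ψ n ⟨$⟩ w)) ,
        ℕ.m≤n⇒m≤n⊔o _ (proj₂ (holds (ψ n ⟨$⟩ w)))

      g : Point K ↣ Tail n₀
      g = mk↣ {to = to} λ {p} {q} eq → injective p q (cong value eq)
        where
        to : Point K → Tail n₀
        to (n , w) = value (ψ n ⟨$⟩ w) , [ lift (ℕ.≤-<-trans
          (increasing⇒monotone edge-< {0} {n} z≤n) (proj₁ (g-height (n , w)))) ]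

        disjoint : ∀ p q → proj₁ p < proj₁ q → value (to p) ≢ value (to q)
        disjoint p q p<q eq = ℕ.<⇒≱ (proj₁ (g-height q)) (ℕ.≤-trans
          (ℕ.≤-reflexive (cong height (sym eq)))
          (ℕ.≤-trans (proj₂ (g-height p)) (increasing⇒monotone edge-< p<q)))

        injective : ∀ p q → value (to p) ≡ value (to q) → p ≡ q
        injective p@(m , v) q@(n , w) eq with ℕ.<-cmp m n
        ... | tri< m<n _ _  = contradiction eq (disjoint p q m<n)
        ... | tri≈ _ refl _ = cong (m ,_) (Injection.injective (ψ m) (value-injective eq))
        ... | tri> _ _ n<m  = contradiction (sym eq) (disjoint q p n<m)

      open Bernstein f g

      -- to agrees pointwise with f or with the inverse of g, so it inherits
      -- control of the layers from both.
      up : Controls (height ∘ value) (proj₁ ∘ to)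
      up n = ν n ⊔ n , λ x hx≤n → go x hx≤n (to-cases x)
        where
        go : ∀ x → height (value x) ≤ n → to x ≡ f ⟨$⟩ x ⊎ g ⟨$⟩ to x ≡ x →
             proj₁ (to x) ≤ ν n ⊔ n
        go x hx≤n (inj₁ eq) = ℕ.m≤n⇒m≤n⊔o n (ℕ.≤-trans
          (ℕ.≤-reflexive (cong proj₁ eq)) (increasing⇒monotone ν-< hx≤n))
        go x hx≤n (inj₂ eq) = ℕ.m≤n⇒m≤o⊔n (ν n) (ℕ.≤-trans
          (increasing⇒≥ edge-< _)
          (ℕ.≤-trans (ℕ.<⇒≤ (proj₁ (g-height (to x))))
            (ℕ.≤-trans (ℕ.≤-reflexive (cong (height ∘ value) eq)) hx≤n)))

      down : Controls (proj₁ ∘ to) (height ∘ value)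
      -- Where the map is `f`, height is at most the layer index. Where it inverts `g`, a point of
      -- layer `i` has height at most `edge (suc i)`.
      down n = n ⊔ edge (suc n) , λ x i≤n → go x i≤n (to-cases x)
        where
        go : ∀ x → proj₁ (to x) ≤ n → to x ≡ f ⟨$⟩ x ⊎ g ⟨$⟩ to x ≡ x →
             height (value x) ≤ n ⊔ edge (suc n)
        go x i≤n (inj₁ eq) = ℕ.m≤n⇒m≤n⊔o _ (ℕ.≤-trans
          (increasing⇒≥ ν-< _)
          (ℕ.≤-trans (ℕ.≤-reflexive (cong proj₁ (sym eq))) i≤n))
        go x i≤n (inj₂ eq) = ℕ.m≤n⇒m≤o⊔n n (ℕ.≤-trans
          (ℕ.≤-reflexive (cong (height ∘ value) (sym eq)))
          (ℕ.≤-trans (proj₂ (g-height (to x)))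
            (increasing⇒monotone edge-< (s≤s i≤n))))

      interleave : CoarselyEquivalent X (T K)
      interleave = coarselyEquivalent K n₀ to bijective up down

    -- The shell injections need not be compatible; the height coordinate records which one was
    -- applied.
    Tail↣ℕ× : ∀ {N} {B : Set b} → (∀ m → Shell N m ↣ B) → Tail N ↣ (ℕ × B)
    Tail↣ℕ× {N = N} f = mk↣ {to = λ x → height (value x) , f _ ⟨$⟩ shell x}
      λ {x} {y} eq → value-injective (injective (shell x) (shell y)
        (,-injectiveˡ eq) (,-injectiveʳ eq))
      where
      shell : (x : Tail N) → Shell N (height (value x))
      shell x = Tail⊆Shell x ℕ.≤-refl

      injective : ∀ {j j′} (s : Shell N j) (t : Shell N j′) → j ≡ j′ →
                  f j ⟨$⟩ s ≡ f j′ ⟨$⟩ t → value s ≡ value t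
      injective s t refl eq = cong value (Injection.injective (f _) eq)

    -- Wide and narrow spaces.

    Wide : Set b → Set (a ⊔ℓ b)
    Wide B = ∀ N → ∃[ m ] B ↣ Shell N m

    wide? : (B : Set b) → Wide B ⊎ (∃[ N ] ∀ m → ¬ (B ↣ Shell N m))
    wide? B with ∀⊎∃¬ (λ N → ∃[ m ] B ↣ Shell N m)
    ... | inj₁ wide    = inj₁ wide
    ... | inj₂ (N , ¬∃) = inj₂ (N , λ m f → ¬∃ (m , f))

    wide⇒constant : (K : Cardinal b) → Carrier ↣ ∣ K ∣ → Wide ∣ K ∣ →
                    -- All blocks equal `K`, into which the whole of `X` injects, so any index
                    -- serves for `inner`.
                    CoarselyEquivalent X (T (const K))
    wide⇒constant K X↣K wide = Interleave.interleave (const K) 0 (λ N _ → wide N)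
      (λ j N → N , ℕ.≤-refl , ⟪⟫-value ⨾ X↣K)

    -- A bijection unbounded on some shell would embed ℕ into that shell. Conversely, only finitely
    -- many points have index at most `n`, so their heights are bounded.
    narrow⇒singletons : ∀ {N} → (∀ m → ¬ (ℕ ↣ Shell N m)) → Tail N ⤖ ℕ →
                        CoarselyEquivalent X (T (const 1ᶜ))
    narrow⇒singletons {N} narrow bij =
      coarselyEquivalent (const 1ᶜ) N (λ x → to x , tt) bijective up down
      where
      open Bijection bij using (to; injective; strictlySurjective)

      bijective : Bijective _≡_ _≡_ (λ x → to x , tt)
      bijective = (λ eq → injective (,-injectiveˡ eq)) ,
        strictlySurjective⇒surjective λ { (n , tt) →
          let x , eq = strictlySurjective n in x , cong (_, tt) eq }

      up : Controls (height ∘ value) to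
      up n with ∀⊎∃¬ (λ c → ∃[ s ] c < to (Shell⊆Tail {N} {n} s))
      ... | inj₁ above    = contradiction (unbounded⇒ℕ↣ _ above) (narrow n)
      ... | inj₂ (c , ¬∃) = c , λ x hx≤n →
              ℕ.≮⇒≥ λ c<x → ¬∃ (Tail⊆Shell x hx≤n , c<x)

      down : Controls to (height ∘ value)
      down n with finite⇒bounded (λ k → height (value (proj₁ (strictlySurjective k)))) n
      ... | c , bound = c , λ x x≤n → subst (λ y → height (value y) ≤ c)
              (injective (proj₂ (strictlySurjective (to x)))) (bound (to x) x≤n)

    -- The three cases for κ.

    module Density (κ : Cardinal a) (X⤖κ : Carrier ⤖ ∣ κ ∣)
                   (density : IsAsymptoticDensity X κ) where

      X↣κ : Carrier ↣ ∣ κ ∣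
      X↣κ = ⤖⇒↣ X⤖κ

      κ↣Tail : ∀ N → ∣ κ ∣ ↣ Tail N
      κ↣Tail N = proj₂ density (Outside N) (Outside-large N)

      shellOrder : ∀ N m → WellOrder (Shell N m)
      shellOrder N m = pullback (⟪⟫-value ⨾ X↣κ) (wellOrder κ)

      countable : κ ≈ᶜ ℵ₀ → CoarselyEquivalent X (T (const 1ᶜ)) ⊎
                            CoarselyEquivalent X (T (const ℵ₀))
      countable κ≈ℵ₀ with wide? ℕ
      ... | inj₁ wide         = inj₂ (wide⇒constant ℵ₀ (X↣κ ⨾ ⤖⇒↣ κ≈ℵ₀) wide)
      ... | inj₂ (N , narrow) = inj₁ (narrow⇒singletons narrow
              (bernstein (⟪⟫-value ⨾ X↣κ ⨾ ⤖⇒↣ κ≈ℵ₀) (⤖⇒↢ κ≈ℵ₀ ⨾ κ↣Tail N)))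

      uncountableCofinality : (μ : Cardinal a) → IsCofinality κ μ → ℵ₀ <ᶜ μ →
                              CoarselyEquivalent X (T (const κ))
      uncountableCofinality μ (_ , μ↣) (ℵ₀≤μ , ℵ₀≉μ) =
        wide⇒constant κ X↣κ ([ id , ⊥-elim ∘ ¬narrow ]′ (wide? ∣ κ ∣))
        where
        open WellOrder (wellOrder κ)

        μ≰ℕ : ¬ (∣ μ ∣ ↣ ℕ)
        μ≰ℕ f = ℵ₀≉μ (bernstein ℵ₀≤μ f)

        κ≰ℕ : ¬ (∣ κ ∣ ↣ ℕ)
        -- All of κ is cofinal in itself, so μ injects into κ.
        κ≰ℕ f = μ≰ℕ (μ↣ (λ _ → Lift a ⊤) (λ x → x , lift tt , inj₂ refl) ⨾ ⟪⟫-value ⨾ f)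

        -- If the range of β were cofinal, μ would inject into it, and choosing an index for each
        -- value would make μ countable.
        sequenceBound : (β : ℕ → ∣ κ ∣) → ∃[ x ] ∀ n → β n ≺ x
        sequenceBound β with ∀⊎∃¬ (λ x → ∃[ y ] (∃[ n ] y ≡ β n) × (x ≺ y ⊎ x ≡ y))
        ... | inj₁ cofinal = contradiction (μ↣ _ cofinal ⨾ index) μ≰ℕ
          where
          index : ⟪ (λ y → ∃[ n ] y ≡ β n) ⟫ ↣ ℕ
          index = mk↣ {to = proj₁ ∘ holds} λ {y} {z} eq → value-injective
            (trans (proj₂ (holds y)) (trans (cong β eq) (sym (proj₂ (holds z)))))
        ... | inj₂ (x , ¬∃) = x , below
          where
          below : ∀ n → β n ≺ x
          below n with compare (β n) x
          ... | tri< β≺x _ _ = β≺x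
          ... | tri≈ _ β≡x _ = contradiction (β n , (n , refl) , inj₂ (sym β≡x)) ¬∃
          ... | tri> _ _ x≺β = contradiction (β n , (n , refl) , inj₁ x≺β) ¬∃

        -- Each shell would inject into a proper segment, and one `x` bounds the ends of all these
        -- segments. So κ would inject into ℕ × `Segment x`, hence into `Segment x`.
        ¬narrow : ¬ (∃[ N ] ∀ m → ¬ (∣ κ ∣ ↣ Shell N m))
        ¬narrow (N , narrow) = ¬↣initial κ x
          (uncountable↣ℕ×⇒↣ κ κ≰ℕ (pullback ⟪⟫-value (wellOrder κ))
            (κ↣Tail N ⨾ Tail↣ℕ× λ m → proj₂ (shell↣ m) ⨾ widen (β≺x m)))
          where
          shell↣ : ∀ m → ∃[ y ] Shell N m ↣ Segment y
          shell↣ m = [ ⊥-elim ∘ narrow m , id ]′ (comparable (shellOrder N m) (wellOrder κ))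

          x   = proj₁ (sequenceBound (proj₁ ∘ shell↣))
          β≺x = proj₂ (sequenceBound (proj₁ ∘ shell↣))

          widen : ∀ {y} → y ≺ x → Segment y ↣ Segment x
          widen y≺x = mk↣ {to = λ { (z , [ z≺y ]) → z , [ ≺-trans z≺y y≺x ] }}
            λ { {z , _} {w , _} eq → value-injective (cong value eq) }

      countableCofinality :
        ℵ₀ <ᶜ κ → (κ′ : ℕ → Cardinal a) →
        (∀ n → κ′ n <ᶜ κ′ (suc n)) → IsSupremum κ′ κ →
        CoarselyEquivalent X (T κ′) ⊎ CoarselyEquivalent X (T (const κ))
      countableCofinality (ℵ₀≤κ , ℵ₀≉κ) κ′ κ′-< (κ′≤κ , supremum) with wide? ∣ κ ∣
      ... | inj₁ wide = inj₂ (wide⇒constant κ X↣κ wide)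
      ... | inj₂ (n₀ , narrow) = inj₁ (Interleave.interleave κ′ n₀ outer inner)
        where
        κ≰ℕ : ¬ (∣ κ ∣ ↣ ℕ)
        κ≰ℕ f = ℵ₀≉κ (bernstein ℵ₀≤κ f)

        -- Otherwise `κ′ (suc n)`, which injects into κ, would be equinumerous with `κ′ n`.
        κ≰κ′ : ∀ n → ¬ (∣ κ ∣ ↣ ∣ κ′ n ∣)
        κ≰κ′ n f = proj₂ (κ′-< n) (bernstein (proj₁ (κ′-< n)) (κ′≤κ (suc n) ⨾ f))

        κ′-mono : ∀ k n → κ′ n ≤ᶜ κ′ (k + n)
        κ′-mono zero    n = ↣-id _
        κ′-mono (suc k) n = κ′-mono k n ⨾ proj₁ (κ′-< (k + n))

        -- Otherwise every shell beyond `N` injects into `κ′ n`, so κ injects into ℕ × `κ′ n` and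
        -- then into `κ′ n`.
        outer : ∀ N n → ∃[ m ] ∣ κ′ n ∣ ↣ Shell N m
        outer N n = byContradiction λ ¬∃ → κ≰κ′ n
          (uncountable↣ℕ×⇒↣ κ κ≰ℕ (wellOrder (κ′ n)) (κ↣Tail N ⨾ Tail↣ℕ× λ m →
            [ (λ f → contradiction (m , f) ¬∃) , id ]′
              (comparable′ (shellOrder N m) (wellOrder (κ′ n)))))

        -- Otherwise every `κ′ n` injects into the shell. The shell's cardinality is then an upper
        -- bound, so κ injects into the shell, against narrowness.
        inner : ∀ j N → ∃[ n ] N ≤ n × (Shell n₀ j ↣ ∣ κ′ n ∣)
        inner j N = byContradiction λ ¬∃ →
          let μ , μ↣S , S↣μ = cardinality (shellOrder n₀ j)
          in narrow j (supremum μ (λ n → κ′-mono N n ⨾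
               [ id , (λ f → contradiction (N + n , ℕ.m≤m+n N n , f) ¬∃) ]′
                 (comparable′ (shellOrder n₀ j) (wellOrder (κ′ (N + n)))) ⨾ S↣μ) ⨾ μ↣S)

theorem7 : (∀ {ℓ} → ExcludedMiddle ℓ) →
    ∀ {a} (X : MetricSpace a) (κ : Cardinal a) →
    Unbounded X → Thin X →
    MetricSpace.Carrier X ⤖ ∣ κ ∣ → IsAsymptoticDensity X κ →
    (κ ≈ᶜ ℵ₀ →
    CoarselyEquivalent X (T (const 1ᶜ)) ⊎
    CoarselyEquivalent X (T (const ℵ₀)))
    ×
    (∀ (μ : Cardinal a) → IsCofinality κ μ → ℵ₀ <ᶜ μ →
    CoarselyEquivalent X (T (const κ)))
    ×
    (ℵ₀ <ᶜ κ → IsCofinality κ ℵ₀ →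
    ∀ (κ′ : ℕ → Cardinal a) →
    (∀ n → κ′ n <ᶜ κ′ (suc n)) → IsSupremum κ′ κ →
    CoarselyEquivalent X (T κ′) ⊎
    CoarselyEquivalent X (T (const κ)))
theorem7 em X κ unbounded thin X⤖κ density =
    (λ κ≈ℵ₀ → countable (⤖⇒↢ κ≈ℵ₀ ⟨$⟩ 0) κ≈ℵ₀)
  , (λ { μ cof@((_ , _ , C⤖μ) , _) ℵ₀<μ →
         uncountableCofinality (value (⤖⇒↢ C⤖μ ⟨$⟩ (proj₁ ℵ₀<μ ⟨$⟩ 0))) μ cof ℵ₀<μ })
  , (λ ℵ₀<κ _ → countableCofinality (proj₁ ℵ₀<κ ⟨$⟩ 0) ℵ₀<κ)
  where
  -- The base point comes from an element of κ, supplied by the hypothesis of each case: a copy of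
  -- ℵ₀ in κ, or an element of a cofinal set.
  open module D (k : ∣ κ ∣) = Classical.Layered.Density em X (⤖⇒↢ X⤖κ ⟨$⟩ k)
                                unbounded thin κ X⤖κ density
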